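{- There is an absolute constant $c>0$ such that the following holds. For every integer $k \geq 3$ there are infinitely many values of $n$ for which there exists an $n$-vertex graph $G$ with \[ \operatorname{pn}_\ell(G) \leq \operatorname{pn}_u(G) \leq k+2 \quad\text{and}\quad \operatorname{pn}(G) \geq c\sqrt{k}\, n^{1/2-1/k}. \] In contrast, for every finite graph $G$ we have $\operatorname{pn}_u(G) \leq 4\operatorname{pn}_\ell(G)+2$.
   Context: All graphs are finite and simple. A linear embedding of a graph $G=(V,E)$ is a pair $(\prec,\mathcal{P})$ where $\prec$ is a total order on $V$ (the spine ordering) and $\mathcal{P}$ is a partition of $E$ into parts called pages. Two edges $uv, xy$ with $u\prec v$, $x \prec y$ cross if $u \prec x \prec v \prec y$ or $x \prec u \prec y \prec v$. A linear embedding is a book embedding if no two crossing edges lie in the same page. The page number $\operatorname{pn}(G)$ is the minimum number of pages in a book embedding of $G$. For a book embedding and a vertex $v$, let $\mathcal{P}_v$ be the set of pages containing at least one edge incident to $v$; the embedding is $k$-local if $|\mathcal{P}_v|\le k$ for all $v$, and the local page number $\operatorname{pn}_\ell(G)$ is the least $k$ such that $G$ has a $k$-local book embedding (with any number of pages). For a page $P$, let $G_P$ be the subgraph consisting of the edges of $P$ and all vertices incident to an edge of $P$. A linear embedding is a union embedding if for every page $P$ and every connected component $C$ of $G_P$, no two edges of $C$ cross. The union page number $\operatorname{pn}_u(G)$ is the minimum number of pages in a union embedding of $G$. -}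

module Defs where

open import Data.Nat using (ℕ; zero; suc; _<_; _≤_)
open import Data.Fin using (Fin; toℕ; _≟_)
open import Data.Fin.Subset using (Subset; ∣_∣)
open import Data.Vec using (tabulate)
open import Data.Bool using (Bool; true; false; _∧_)
open import Data.List using (allFin)
open import Data.Bool.ListAction using (any)
open import Data.Product using (Σ; ∃; _×_)
open import Relation.Nullary using (¬_)
open import Relation.Nullary.Decidable using (⌊_⌋)
open import Relation.Binary.PropositionalEquality using (_≡_; _≢_)
open import Function.Definitions using (Injective)

record Graph (n : ℕ) : Set where
  field
    adj   : Fin n → Fin n → Bool
    sym   : ∀ u v → adj u v ≡ adj v u
    irrefl : ∀ u → adj u u ≡ false

open Graph public

Adj : ∀ {n} → Graph n → Fin n → Fin n → Set
Adj G u v = adj G u v ≡ true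

-- A linear embedding with (at most) m pages: a total order on the vertices,
-- given by an injective position map, and a partition of the edge set into
-- pages labelled by Fin m (the page of edge uv is  page u v = page v u).
-- Empty labels are allowed; this does not affect minimum page counts.
record LinEmb {n : ℕ} (G : Graph n) (m : ℕ) : Set where
  field
    pos     : Fin n → Fin n
    pos-inj : Injective _≡_ _≡_ pos
    page    : Fin n → Fin n → Fin m
    page-sym : ∀ u v → Adj G u v → page u v ≡ page v u

open LinEmb public

_≺[_]_ : ∀ {n m} {G : Graph n} → Fin n → LinEmb G m → Fin n → Set
u ≺[ L ] v = toℕ (pos L u) < toℕ (pos L v)

-- Edges uv and xy (oriented as given) cross when u ≺ x ≺ v ≺ y.
-- Since the conditions below quantify over both orientations of both
-- edges, this captures the symmetric definition of crossing.
Cross : ∀ {n m} {G : Graph n} → LinEmb G m → Fin n → Fin n → Fin n → Fin n → Set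
Cross L u v x y = (u ≺[ L ] x) × (x ≺[ L ] v) × (v ≺[ L ] y)

IsBook : ∀ {n m} {G : Graph n} → LinEmb G m → Set
IsBook {G = G} L = ∀ u v x y → Adj G u v → Adj G x y →
  Cross L u v x y → page L u v ≢ page L x y

BookEmb : ∀ {n} → Graph n → ℕ → Set
BookEmb G m = Σ (LinEmb G m) IsBook

pagesAt : ∀ {n m} {G : Graph n} → LinEmb G m → Fin n → Subset m
pagesAt {n} {G = G} L v =
  tabulate (λ P → any (λ u → adj G v u ∧ ⌊ page L v u ≟ P ⌋) (allFin n))

HasLocalBook : ∀ {n} → Graph n → ℕ → Set
HasLocalBook G k = ∃ λ m → Σ (LinEmb G m) λ L → IsBook L × (∀ v → ∣ pagesAt L v ∣ ≤ k)

data PageConn {n m} {G : Graph n} (L : LinEmb G m) (P : Fin m) : Fin n → Fin n → Set where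
  here : ∀ {u} → PageConn L P u u
  step : ∀ {u w v} → Adj G u w → page L u w ≡ P → PageConn L P w v → PageConn L P u v

IsUnion : ∀ {n m} {G : Graph n} → LinEmb G m → Set
IsUnion {G = G} L = ∀ u v x y → Adj G u v → Adj G x y →
  page L u v ≡ page L x y → PageConn L (page L u v) u x → ¬ Cross L u v x y

UnionEmb : ∀ {n} → Graph n → ℕ → Set
UnionEmb G m = Σ (LinEmb G m) IsUnion

{-# OPTIONS --safe #-}

-- Lower bound.  Take the union of k + 2 perfect matchings between two halves of size N = 2 ^ r.
-- Each matching is a page without crossing components.  In a book embedding, the spine order
-- together with the page and the direction of the i-th matching edge at every vertex determines
-- the matchings, as a noncrossing matching is recovered from its opening and closing ends.  So if all
-- (N !) ^ (k + 2) choices of matchings had embeddings with m pages, this number would be at most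
-- n ^ n * (2 * m) ^ (n * (k + 2)) for n = 2 * N, forcing n ^ k ≤ (32 * m ^ 2) ^ (k + 2).
--
-- Upper bound.  In a noncrossing page every edge is the longest one to the right at its left end
-- or the longest one to the left at its right end.  Hence an l-local book embedding splits the edges
-- into l forests directed to the right and l forests directed to the left.  Cutting each forest by
-- the parity of the depth gives star forests, in which no two edges of a component cross.

module Submission where

open import Defs hiding (sym)
open import Data.Bool using (true)
import Data.Bool.Properties as Bool
open import Data.Bool.Properties using (T-≡; T-∧)
open import Data.Empty using (⊥)
open import Data.Fin using (Fin; zero; suc; toℕ; combine; remQuot; quotient; remainder; inject≤;
  splitAt; _↑ˡ_; _↑ʳ_; opposite; punchIn; funToFin; finToFun; _≟_)
import Data.Fin.Permutation as Permutation
open import Data.Fin.Permutation using (Permutation′; _⟨$⟩ʳ_; _⟨$⟩ˡ_; inverseˡ; inverseʳ; insert;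
  insert-punchIn; _≈_)
import Data.Fin.Properties as Fin
open import Data.Fin.Properties using (any?; all?; <-cmp; toℕ-injective; toℕ<n;
  combine-injective; remQuot-combine; combine-remQuot; inject≤-injective; injective⇒≤;
  <⇒notInjective; opposite-prop; opposite-involutive; splitAt-↑ˡ; splitAt-↑ʳ; splitAt⁻¹-↑ˡ;
  splitAt⁻¹-↑ʳ; ↑ʳ-injective; punchIn-injective; finToFun-funToFin; funToFin-finToFin; ¬∀⟶∃¬)
open import Data.Fin.Subset using (Subset; ∣_∣; inside; outside; _∈_)
open import Data.List using (List; []; _∷_; allFin; cartesianProduct)
import Data.List.Membership.Propositional as List
open import Data.List.Membership.Propositional.Properties using (∈-allFin; ∈-cartesianProduct⁺)
open import Data.List.Relation.Unary.Any using (here; there; satisfied)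
open import Data.List.Relation.Unary.Any.Properties using (any⁺; any⁻)
open import Data.Nat using (ℕ; zero; suc; _≤_; _<_; _+_; _*_; _^_; _∸_; _!; z≤n; s≤s; s≤s⁻¹;
  NonZero; >-nonZero)
open import Data.Nat.Properties using (≤-refl; ≤-reflexive; ≤-trans; ≤-antisym; <-trans; <-irrefl;
  ≤-<-trans; <-≤-trans; <⇒≤; <⇒≱; ≮⇒≥; ≰⇒>; _<?_; _≤?_; m≤m+n; m≤n+m; m≤m*n; +-identityʳ;
  +-monoˡ-≤; *-assoc; *-comm; *-identityˡ; *-identityʳ; *-mono-≤; *-monoˡ-≤; *-monoʳ-≤;
  *-cancelˡ-≤; m*n≢0; ∸-monoʳ-<; ^-distribˡ-+-*; ^-*-assoc; ^-zeroˡ; ^-monoˡ-≤; ^-monoˡ-<; m^n≢0;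
  m^n>0; module ≤-Reasoning)
open import Data.Nat.Solver using (module +-*-Solver)
open import Data.Product using (Σ; ∃; _×_; _,_; proj₁; proj₂; map₂)
open import Data.Sum using (_⊎_; inj₁; inj₂; [_,_]′)
open import Data.Vec using (_∷_; here; there)
open import Data.Vec.Properties using ([]=⇒lookup; lookup⇒[]=; lookup∘tabulate)
open import Function using (_∘_; Equivalence; mk⇔)
open import Function.Definitions using (Injective)
open import Relation.Binary.Definitions using (tri<; tri≈; tri>)
open import Relation.Binary.PropositionalEquality using (_≡_; _≢_; _≗_; refl; sym; trans; cong;
  cong₂; subst; subst₂)
open import Relation.Nullary using (¬_; Dec; yes; no; does; contradiction; ¬?)
open import Relation.Nullary.Decidable using (_×-dec_; _⊎-dec_; _→-dec_; toWitness; fromWitness;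
  toSum; does-⇔; dec-true; dec-false)
open +-*-Solver using (solve; con; _:+_; _:*_; _:=_)
open ≤-Reasoning

-- Adjacency, symmetric page functions and connectivity within a page

Adj⇒≢ : ∀ {n} (G : Graph n) {u v} → Adj G u v → u ≢ v
Adj⇒≢ G {u} uv refl with trans (sym uv) (irrefl G u)
... | ()

Adj-sym : ∀ {n} (G : Graph n) {u v} → Adj G u v → Adj G v u
Adj-sym G {u} {v} uv = trans (Graph.sym G v u) uv

Adj? : ∀ {n} (G : Graph n) u v → Dec (Adj G u v)
Adj? G u v = adj G u v Bool.≟ true

page≡-sym : ∀ {n m} {G : Graph n} (L : LinEmb G m) {u v} {P : Fin m} →
  Adj G u v → page L u v ≡ P → page L v u ≡ P
page≡-sym {G = G} L {u} {v} uv uv∈P = trans (sym (page-sym L u v uv)) uv∈P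

-- A search for a page may answer differently for `u v` and `v u`. Consulting only the increasing
-- order of the two arguments makes the result symmetric by construction.
symmetrise : ∀ {n} {A : Set} → (Fin n → Fin n → A) → Fin n → Fin n → A
symmetrise f u v with <-cmp u v
... | tri< _ _ _ = f u v
... | tri≈ _ _ _ = f u v
... | tri> _ _ _ = f v u

symmetrise-sym : ∀ {n} {A : Set} (f : Fin n → Fin n → A) u v →
  symmetrise f u v ≡ symmetrise f v u
symmetrise-sym f u v with <-cmp u v | <-cmp v u
... | tri< _ _ _    | tri> _ _ _    = refl
... | tri> _ _ _    | tri< _ _ _    = refl
... | tri≈ _ refl _ | tri≈ _ _ _    = refl
... | tri≈ _ refl _ | tri< _ u≢u _  = contradiction refl u≢u
... | tri≈ _ refl _ | tri> _ u≢u _  = contradiction refl u≢u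
... | tri< u<v _ _  | tri< _ _ v≯u  = contradiction u<v v≯u
... | tri< _ u≢v _  | tri≈ _ v≡u _  = contradiction (sym v≡u) u≢v
... | tri> _ _ v<u  | tri> v≮u _ _  = contradiction v<u v≮u
... | tri> _ u≢v _  | tri≈ _ v≡u _  = contradiction (sym v≡u) u≢v

symmetrise-cases : ∀ {n} {A : Set} (R : A → Set) (f : Fin n → Fin n → A) u v →
  R (f u v) → R (f v u) → R (symmetrise f u v)
symmetrise-cases R f u v Ruv Rvu with <-cmp u v
... | tri< _ _ _ = Ruv
... | tri≈ _ _ _ = Ruv
... | tri> _ _ _ = Rvu

module _ {n m} {G : Graph n} (L : LinEmb G m) where

  PageConn-trans : ∀ {P u v w} → PageConn L P u v → PageConn L P v w → PageConn L P u w
  PageConn-trans here            q = q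
  PageConn-trans (step uw w∈P p) q = step uw w∈P (PageConn-trans p q)

  PageConn-sym : ∀ {P u v} → PageConn L P u v → PageConn L P v u
  PageConn-sym here            = here
  PageConn-sym (step uw w∈P p) =
    PageConn-trans (PageConn-sym p) (step (Adj-sym G uw) (page≡-sym L uw w∈P) here)

  PageConn-invariant : ∀ {A : Set} {P} (f : Fin n → A) →
    (∀ {u v} → Adj G u v → page L u v ≡ P → f u ≡ f v) →
    ∀ {u v} → PageConn L P u v → f u ≡ f v
  PageConn-invariant f f-edge here              = refl
  PageConn-invariant f f-edge (step uw uw∈P p) =
    trans (f-edge uw uw∈P) (PageConn-invariant f f-edge p)

  -- `centre` is constant along the edges of a page, so two edges of one component have the same
  -- centre and thus a common end. The four ends of a crossing are distinct.
  stars⇒union : (centre : Fin m → Fin n → Fin n) →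
    (∀ {u v} → Adj G u v → centre (page L u v) u ≡ centre (page L u v) v) →
    (∀ {u v} → Adj G u v → centre (page L u v) u ≡ u ⊎ centre (page L u v) u ≡ v) →
    IsUnion L
  stars⇒union centre const end u v x y uv xy P≡Q conn (u≺x , x≺v , v≺y)
    with end uv | end xy
       | subst (λ Q → centre (page L u v) u ≡ centre Q x) P≡Q
           (PageConn-invariant (centre (page L u v))
             (λ {w} {z} wz wz∈P → subst (λ Q → centre Q w ≡ centre Q z) wz∈P (const wz)) conn)
  ... | inj₁ p | inj₁ q | r = <-irrefl (cong (toℕ ∘ pos L) (trans (sym p) (trans r q))) u≺x
  ... | inj₁ p | inj₂ q | r = <-irrefl (cong (toℕ ∘ pos L) (trans (sym p) (trans r q)))
    (<-trans u≺x (<-trans x≺v v≺y))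
  ... | inj₂ p | inj₁ q | r = <-irrefl (cong (toℕ ∘ pos L) (sym (trans (sym p) (trans r q)))) x≺v
  ... | inj₂ p | inj₂ q | r = <-irrefl (cong (toℕ ∘ pos L) (trans (sym p) (trans r q))) v≺y

  ∈-pagesAt⁺ : ∀ {u v} → Adj G u v → page L u v ∈ pagesAt L u
  ∈-pagesAt⁺ {u} {v} uv = lookup⇒[]= P (pagesAt L u) (trans (lookup∘tabulate _ P)
    (Equivalence.to T-≡ (any⁺ _ (List.lose (∈-allFin v)
      (Equivalence.from T-∧ (Equivalence.from T-≡ uv , fromWitness {a? = page L u v ≟ P} refl))))))
    where P = page L u v

  ∈-pagesAt⁻ : ∀ {u P} → P ∈ pagesAt L u → ∃ λ v → Adj G u v × page L u v ≡ P
  ∈-pagesAt⁻ {u} {P} P∈ with satisfied (any⁻ _ (allFin n) (Equivalence.from T-≡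
    (trans (sym (lookup∘tabulate _ P)) ([]=⇒lookup P∈))))
  ... | v , t with Equivalence.to T-∧ t
  ...   | uv , P≡ = v , Equivalence.to T-≡ uv , toWitness {a? = page L u v ≟ P} P≡

-- Enumerating the elements of a subset

select : ∀ {n} (S : Subset n) → Fin ∣ S ∣ → Fin n
select (inside  ∷ S) zero    = zero
select (inside  ∷ S) (suc i) = suc (select S i)
select (outside ∷ S) i       = suc (select S i)

select-injective : ∀ {n} (S : Subset n) → Injective _≡_ _≡_ (select S)
select-injective (inside  ∷ S) {zero}  {zero}  _  = refl
select-injective (inside  ∷ S) {suc i} {suc j} eq =
  cong suc (select-injective S (Fin.suc-injective eq))
select-injective (outside ∷ S) eq = select-injective S (Fin.suc-injective eq)

select-∈ : ∀ {n} (S : Subset n) i → select S i ∈ S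
select-∈ (inside  ∷ S) zero    = here
select-∈ (inside  ∷ S) (suc i) = there (select-∈ S i)
select-∈ (outside ∷ S) i       = there (select-∈ S i)

select-surjective : ∀ {n} (S : Subset n) {x} → x ∈ S → ∃ λ i → select S i ≡ x
select-surjective (inside  ∷ S) here       = zero , refl
select-surjective (inside  ∷ S) (there x∈) with select-surjective S x∈
... | i , refl = suc i , refl
select-surjective (outside ∷ S) (there x∈) with select-surjective S x∈
... | i , refl = i , refl

∣S∣≤size-of-cover : ∀ {m n} (S : Subset n) (g : Fin m → Fin n) →
  (∀ {x} → x ∈ S → ∃ λ i → g i ≡ x) → ∣ S ∣ ≤ m
∣S∣≤size-of-cover S g cover = injective⇒≤ {f = λ i → proj₁ (cover (select-∈ S i))} λ {i} {j} eq →
  select-injective S (trans (sym (proj₂ (cover (select-∈ S i))))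
    (trans (cong g eq) (proj₂ (cover (select-∈ S j)))))

-- Connected components

module _ {n m} {G : Graph n} (L : LinEmb G m) (P : Fin m) where

  private
    merge : Fin n → Fin n → Fin n → Fin n
    merge a b c with c ≟ a
    ... | yes _ = b
    ... | no  _ = c

    merge-identifies : ∀ a b → merge a b a ≡ merge a b b
    merge-identifies a b with a ≟ a | b ≟ a
    ... | yes _   | yes _ = refl
    ... | yes _   | no  _ = refl
    ... | no a≢a  | _     = contradiction refl a≢a

  -- As in union-find, edges are processed one by one, each merging the labels of its ends. Equal
  -- labels always certify a connection, and once all pairs are processed the label classes are the
  -- components.
  componentLabelOn : (es : List (Fin n × Fin n)) → Σ (Fin n → Fin n) λ ℓ →
    (∀ {u v} → (u , v) List.∈ es → Adj G u v → page L u v ≡ P → ℓ u ≡ ℓ v)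
    × (∀ u v → ℓ u ≡ ℓ v → PageConn L P u v)
  componentLabelOn [] = (λ u → u) , (λ ()) , λ { u .u refl → here }
  componentLabelOn ((a , b) ∷ es)
    with componentLabelOn es | Adj? G a b ×-dec (page L a b ≟ P)
  ... | ℓ , edge , conn | no ¬ab = ℓ , edge′ , conn
    where
    edge′ : ∀ {u v} → (u , v) List.∈ ((a , b) ∷ es) → Adj G u v → page L u v ≡ P → ℓ u ≡ ℓ v
    edge′ (here refl) ab ab∈P = contradiction (ab , ab∈P) ¬ab
    edge′ (there uv∈) = edge uv∈
  ... | ℓ , edge , conn | yes (ab , ab∈P) = merge (ℓ a) (ℓ b) ∘ ℓ , edge′ , conn′
    where
    a~b : PageConn L P a b
    a~b = step ab ab∈P here
    edge′ : ∀ {u v} → (u , v) List.∈ ((a , b) ∷ es) → Adj G u v → page L u v ≡ P →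
      merge (ℓ a) (ℓ b) (ℓ u) ≡ merge (ℓ a) (ℓ b) (ℓ v)
    edge′ (here refl) _  _    = merge-identifies (ℓ a) (ℓ b)
    edge′ (there uv∈) uv uv∈P = cong (merge (ℓ a) (ℓ b)) (edge uv∈ uv uv∈P)
    conn′ : ∀ u v → merge (ℓ a) (ℓ b) (ℓ u) ≡ merge (ℓ a) (ℓ b) (ℓ v) → PageConn L P u v
    conn′ u v eq with ℓ u ≟ ℓ a | ℓ v ≟ ℓ a
    ... | yes p | yes q = conn u v (trans p (sym q))
    -- Only `u` was relabelled, from the label of `a` to that of `b`, so the connection runs through
    -- the new edge.
    ... | yes p | no  _ = PageConn-trans L (conn u a p) (PageConn-trans L a~b (conn b v eq))
    ... | no  _ | yes q = PageConn-trans L (conn u b eq)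
      (PageConn-trans L (PageConn-sym L a~b) (conn a v (sym q)))
    ... | no  _ | no  _ = conn u v eq

  component : Fin n → Fin n
  component = proj₁ (componentLabelOn (cartesianProduct (allFin n) (allFin n)))

  component-edge : ∀ {u v} → Adj G u v → page L u v ≡ P → component u ≡ component v
  component-edge {u} {v} = proj₁ (proj₂ (componentLabelOn (cartesianProduct (allFin n) (allFin n))))
    (∈-cartesianProduct⁺ (∈-allFin u) (∈-allFin v))

  component-conn : ∀ u v → component u ≡ component v → PageConn L P u v
  component-conn = proj₂ (proj₂ (componentLabelOn (cartesianProduct (allFin n) (allFin n))))

-- The components of the old pages become the new pages. Edges of one component do not cross, and a
-- vertex meets only one component of each old page.
union⇒localBook : ∀ {n} {G : Graph n} {m} → UnionEmb G m → HasLocalBook G m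
union⇒localBook {n} {G} {m} (L , union) = m * n , L′ , book , local
  where
  comp : Fin m → Fin n → Fin n
  comp = component L

  L′ : LinEmb G (m * n)
  L′ = record
    { pos      = pos L
    ; pos-inj  = pos-inj L
    ; page     = λ u v → combine (page L u v) (comp (page L u v) u)
    ; page-sym = λ u v uv → trans (cong (combine (page L u v)) (component-edge L _ uv refl))
                              (cong (λ P → combine P (comp P v)) (page-sym L u v uv))
    }

  book : IsBook L′
  book u v x y uv xy cross eq with combine-injective (page L u v) _ (page L x y) _ eq
  ... | P≡Q , ℓ≡ = union u v x y uv xy P≡Q
    (component-conn L _ u x (trans ℓ≡ (cong (λ P → comp P x) (sym P≡Q)))) cross

  local : ∀ v → ∣ pagesAt L′ v ∣ ≤ m
  local v = ∣S∣≤size-of-cover (pagesAt L′ v) (λ P → combine P (comp P v)) λ Q∈ →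
    let (u , _ , eq) = ∈-pagesAt⁻ L′ Q∈ in page L v u , eq

-- Star forests from forests

opposite₂-≢ : (c : Fin 2) → c ≢ opposite c
opposite₂-≢ zero       ()
opposite₂-≢ (suc zero) ()

module _ {n} (Parent : Fin n → Fin n → Set)
  (Parent? : ∀ u v → Dec (Parent u v))
  (functional : ∀ {u v w} → Parent u v → Parent u w → v ≡ w)
  (height : Fin n → Fin n)
  (decreasing : ∀ {u v} → Parent u v → toℕ (height v) < toℕ (height u)) where

  -- Parity of the depth, built upwards in height. A stage recolours every vertex of height at least
  -- `B` that has a parent; at height exactly `B` this is final, since the parent lies lower and
  -- keeps its colour.
  colouringBelow : (B : ℕ) → Σ (Fin n → Fin 2) λ col →
    ∀ {u v} → Parent u v → toℕ (height u) < B → col v ≢ col u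
  colouringBelow zero = (λ _ → zero) , λ _ ()
  colouringBelow (suc B) with colouringBelow B
  ... | col , proper = col′ , proper′
    where
    col′ : Fin n → Fin 2
    col′ u with toℕ (height u) <? B | any? (Parent? u)
    ... | no _ | yes (v , _) = opposite (col v)
    ... | _    | _           = col u
    col′-low : ∀ u → toℕ (height u) < B → col′ u ≡ col u
    col′-low u low with toℕ (height u) <? B
    ... | yes _  = refl
    ... | no ¬low = contradiction low ¬low
    col′-high : ∀ {u v} → ¬ toℕ (height u) < B → Parent u v → col′ u ≡ opposite (col v)
    col′-high {u} {v} high uv with toℕ (height u) <? B | any? (Parent? u)
    ... | yes low | _            = contradiction low high
    ... | no _    | yes (w , uw) = cong (opposite ∘ col) (functional uw uv)
    ... | no _    | no ¬uv       = contradiction (v , uv) ¬uv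
    proper′ : ∀ {u v} → Parent u v → toℕ (height u) < suc B → col′ v ≢ col′ u
    proper′ {u} {v} uv u<1+B eq = [ low , high ]′ (toSum (toℕ (height u) <? B))
      where
      low : ¬ toℕ (height u) < B
      low u<B = proper uv u<B
        (trans (sym (col′-low v (<-trans (decreasing uv) u<B))) (trans eq (col′-low u u<B)))
      high : ¬ ¬ toℕ (height u) < B
      high u≮B = opposite₂-≢ (col v)
        (trans (sym (col′-low v (<-≤-trans (decreasing uv) (s≤s⁻¹ u<1+B))))
          (trans eq (col′-high u≮B uv)))

  two-colouring : Σ (Fin n → Fin 2) λ col → ∀ {u v} → Parent u v → col v ≢ col u
  two-colouring = let (col , proper) = colouringBelow n in col , λ {u} uv → proper uv (toℕ<n (height u))

module _ {n} (G : Graph n) (p : Fin n → Fin n) (p-injective : Injective _≡_ _≡_ p) {t : ℕ}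
  (Parent : Fin (suc t) → Fin n → Fin n → Set)
  (Parent? : ∀ s u v → Dec (Parent s u v))
  (functional : ∀ s {u v w} → Parent s u v → Parent s u w → v ≡ w)
  (height : Fin (suc t) → Fin n → Fin n)
  (decreasing : ∀ s {u v} → Parent s u v → toℕ (height s v) < toℕ (height s u))
  (covered : ∀ {u v} → Adj G u v → ∃ λ s → Parent s u v ⊎ Parent s v u) where

  private
    Label : Set
    Label = Fin (suc t * 2)

    forest : Label → Fin (suc t)
    forest Q = proj₁ (remQuot {suc t} 2 Q)

    class : Label → Fin 2
    class Q = proj₂ (remQuot {suc t} 2 Q)

    colours : ∀ s → Σ (Fin n → Fin 2) λ col → ∀ {u v} → Parent s u v → col v ≢ col u
    colours s = two-colouring (Parent s) (Parent? s) (functional s) (height s) (decreasing s)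

    col : Fin (suc t) → Fin n → Fin 2
    col s = proj₁ (colours s)

    -- The edges of a forest are split by the colour of the child. As the parent has the other
    -- colour, it is not itself a child in the same class, so each class consists of stars centred
    -- at parents.
    StarEdge : Label → Fin n → Fin n → Set
    StarEdge Q u v = Parent (forest Q) u v × col (forest Q) u ≡ class Q

    StarEdge? : ∀ Q u v → Dec (StarEdge Q u v)
    StarEdge? Q u v = Parent? (forest Q) u v ×-dec (col (forest Q) u ≟ class Q)

    Joined : Fin n → Fin n → Label → Set
    Joined u v Q = StarEdge Q u v ⊎ StarEdge Q v u

    Joined-sym : ∀ {u v} Q → Joined u v Q → Joined v u Q
    Joined-sym _ (inj₁ e) = inj₂ e
    Joined-sym _ (inj₂ e) = inj₁ e

    starEdge : ∀ {s u v} → Parent s u v → StarEdge (combine s (col s u)) u v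
    starEdge {s} {u} {v} uv = subst (λ (s′ , c) → Parent s′ u v × col s′ u ≡ c)
      (sym (remQuot-combine s (col s u))) (uv , refl)

    joined : ∀ {u v} → Adj G u v → ∃ (Joined u v)
    joined uv with covered uv
    ... | s , inj₁ e = combine s _ , inj₁ (starEdge e)
    ... | s , inj₂ e = combine s _ , inj₂ (starEdge e)

    label : Fin n → Fin n → Label
    label u v with any? (λ Q → StarEdge? Q u v ⊎-dec StarEdge? Q v u)
    ... | yes (Q , _) = Q
    -- Reached only for non-edges; a label exists because there are `suc t` forests.
    ... | no  _       = zero

    label-joined : ∀ {u v} → Adj G u v → Joined u v (label u v)
    label-joined {u} {v} uv with any? (λ Q → StarEdge? Q u v ⊎-dec StarEdge? Q v u)
    ... | yes (_ , e) = e
    ... | no ¬e       = contradiction (joined uv) ¬e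

    L : LinEmb G (suc t * 2)
    L = record
      { pos = p ; pos-inj = p-injective
      ; page = symmetrise label ; page-sym = λ u v _ → symmetrise-sym label u v }

    page-joined : ∀ {u v} → Adj G u v → Joined u v (page L u v)
    page-joined {u} {v} uv = symmetrise-cases (Joined u v) label u v
      (label-joined uv) (Joined-sym (label v u) (label-joined (Adj-sym G uv)))

    centre : Label → Fin n → Fin n
    centre Q u with any? (StarEdge? Q u)
    ... | yes (v , _) = v
    -- A vertex that is not a leaf in this class is the centre of its own, possibly trivial, star.
    ... | no  _       = u

    centre-leaf : ∀ {Q u v} → StarEdge Q u v → centre Q u ≡ v
    centre-leaf {Q} {u} {v} e with any? (StarEdge? Q u)
    ... | yes (_ , e′) = functional (forest Q) (proj₁ e′) (proj₁ e)
    ... | no ¬e        = contradiction (v , e) ¬e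

    centre-centre : ∀ {Q u v} → StarEdge Q u v → centre Q v ≡ v
    centre-centre {Q} {u} {v} (uv , c) with any? (StarEdge? Q v)
    ... | yes (_ , _ , c′) = contradiction (trans c′ (sym c)) (proj₂ (colours (forest Q)) uv)
    ... | no  _            = refl

    centre-const : ∀ {u v Q} → Joined u v Q → centre Q u ≡ centre Q v
    centre-const (inj₁ e) = trans (centre-leaf e) (sym (centre-centre e))
    centre-const (inj₂ e) = trans (centre-centre e) (sym (centre-leaf e))

    centre-end : ∀ {u v Q} → Joined u v Q → centre Q u ≡ u ⊎ centre Q u ≡ v
    centre-end (inj₁ e) = inj₂ (centre-leaf e)
    centre-end (inj₂ e) = inj₁ (centre-centre e)

  forests⇒union : UnionEmb G (suc t * 2)
  forests⇒union = L , stars⇒union L centre (centre-const ∘ page-joined) (centre-end ∘ page-joined)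

-- Forests from a local book embedding

opposite-< : ∀ {n} {i j : Fin n} → toℕ i < toℕ j → toℕ (opposite j) < toℕ (opposite i)
opposite-< {n} {i} {j} i<j rewrite opposite-prop i | opposite-prop j = ∸-monoʳ-< (s≤s i<j) (toℕ<n j)

opposite-<⁻ : ∀ {n} {i j : Fin n} → toℕ (opposite j) < toℕ (opposite i) → toℕ i < toℕ j
opposite-<⁻ {i = i} {j} lt with opposite-< lt
... | lt′ rewrite opposite-involutive i | opposite-involutive j = lt′

opposite-injective : ∀ {n} → Injective _≡_ _≡_ (opposite {n})
opposite-injective {x = i} {j} eq =
  trans (sym (opposite-involutive i)) (trans (cong opposite eq) (opposite-involutive j))

module _ {n m l} {G : Graph n} (L : LinEmb G m) (local : ∀ v → ∣ pagesAt L v ∣ ≤ l) where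

  private
    -- Every vertex numbers its own pages, so `l` indices suffice for any number `m` of pages. One
    -- page may get different numbers at different vertices: a forest only has to give each vertex
    -- at most one parent.
    Slot : Fin n → Fin m → Fin l → Set
    Slot u P i = ∃ λ j → inject≤ j (local u) ≡ i × select (pagesAt L u) j ≡ P

    Slot-functional : ∀ {u P Q i} → Slot u P i → Slot u Q i → P ≡ Q
    Slot-functional {u} (j , refl , refl) (j′ , eq , refl) =
      cong (select (pagesAt L u)) (sym (inject≤-injective (local u) (local u) j′ j eq))

    slot : ∀ {u v} → Adj G u v → ∃ (Slot u (page L u v))
    slot {u} uv with select-surjective (pagesAt L u) (∈-pagesAt⁺ L uv)
    ... | j , eq = inject≤ j (local u) , j , refl , eq

  LowestNeighbour : (key : Fin n → Fin n) → Fin n → Fin n → Set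
  LowestNeighbour key u v =
    ∀ w → Adj G u w → page L u w ≡ page L u v → toℕ (key v) ≤ toℕ (key w)

  -- The longest edge at `u` towards smaller keys on the page numbered `i` at `u`. The key drops
  -- towards the parent, which rules out cycles.
  Parent : (key : Fin n → Fin n) → Fin l → Fin n → Fin n → Set
  Parent key i u v = (Adj G u v × toℕ (key v) < toℕ (key u))
    × LowestNeighbour key u v × Slot u (page L u v) i

  LowestNeighbour? : ∀ key u v → Dec (LowestNeighbour key u v)
  LowestNeighbour? key u v = all? λ w →
    Adj? G u w →-dec ((page L u w ≟ page L u v) →-dec (toℕ (key v) ≤? toℕ (key w)))

  Parent? : ∀ key i u v → Dec (Parent key i u v)
  Parent? key i u v = (Adj? G u v ×-dec (toℕ (key v) <? toℕ (key u)))
    ×-dec (LowestNeighbour? key u v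
    ×-dec any? (λ j → (inject≤ j (local u) ≟ i) ×-dec (select (pagesAt L u) j ≟ page L u v)))

  Parent-functional : ∀ {key} → Injective _≡_ _≡_ key → ∀ {i u v w} →
    Parent key i u v → Parent key i u w → v ≡ w
  Parent-functional key-inj {u = u} {v} {w} ((uv , _) , lowV , slotV) ((uw , _) , lowW , slotW) =
    key-inj (toℕ-injective (≤-antisym (lowV w uw (sym same)) (lowW v uv same)))
    where
    same : page L u v ≡ page L u w
    same = Slot-functional slotV slotW

  module _ (book : IsBook L) where

    -- Reversing the positions lets one notion of parent serve both directions of the spine.
    leftwards rightwards : Fin n → Fin n
    leftwards  = pos L
    rightwards = opposite ∘ pos L

    -- Otherwise a longer edge to the right at u would cross a longer edge to the left at v.
    longest-edge : ∀ {u v} → Adj G u v → u ≺[ L ] v →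
      LowestNeighbour rightwards u v ⊎ LowestNeighbour leftwards v u
    longest-edge {u} {v} uv u≺v with LowestNeighbour? leftwards v u
    ... | yes low = inj₂ low
    ... | no ¬low = inj₁ λ w uw same → ≮⇒≥ λ w>v → ¬low λ x vx same′ → ≮⇒≥ λ x≺u →
      book x v u w (Adj-sym G vx) uw (x≺u , u≺v , opposite-<⁻ w>v)
        (trans (page≡-sym L vx same′) (trans (page-sym L v u (Adj-sym G uv)) (sym same)))

    parent : ∀ {u v} → Adj G u v → u ≺[ L ] v →
      ∃ (λ i → Parent rightwards i u v) ⊎ ∃ (λ i → Parent leftwards i v u)
    parent uv u≺v with longest-edge uv u≺v
    ... | inj₁ low = let (i , s) = slot uv in inj₁ (i , (uv , opposite-< u≺v) , low , s)
    ... | inj₂ low = let vu = Adj-sym G uv ; (i , s) = slot vu in inj₂ (i , (vu , u≺v) , low , s)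

    private
      SidedParent : Fin n → Fin n → Fin l ⊎ Fin l → Set
      SidedParent u v = [ (λ i → Parent rightwards i u v) , (λ i → Parent leftwards i u v) ]′

      -- Forest zero is empty; it only serves as a page for the non-edges.
      ForestParent : Fin (suc (l + l)) → Fin n → Fin n → Set
      ForestParent zero    u v = ⊥
      ForestParent (suc s) u v = SidedParent u v (splitAt l s)

      key : Fin (suc (l + l)) → Fin n → Fin n
      key zero    = leftwards
      key (suc s) = [ (λ _ → rightwards) , (λ _ → leftwards) ]′ (splitAt l s)

      ForestParent? : ∀ s u v → Dec (ForestParent s u v)
      ForestParent? zero u v = no λ ()
      ForestParent? (suc s) u v with splitAt l s
      ... | inj₁ i = Parent? rightwards i u v
      ... | inj₂ i = Parent? leftwards i u v

      functional : ∀ s {u v w} → ForestParent s u v → ForestParent s u w → v ≡ w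
      functional (suc s) with splitAt l s
      ... | inj₁ i = Parent-functional (pos-inj L ∘ opposite-injective)
      ... | inj₂ i = Parent-functional (pos-inj L)

      decreasing : ∀ s {u v} → ForestParent s u v → toℕ (key s v) < toℕ (key s u)
      decreasing (suc s) with splitAt l s
      ... | inj₁ i = proj₂ ∘ proj₁
      ... | inj₂ i = proj₂ ∘ proj₁

      rightwardForest : ∀ {u v} → ∃ (λ i → Parent rightwards i u v) → ∃ λ s → ForestParent s u v
      rightwardForest {u} {v} (i , e) = suc (i ↑ˡ l) , subst (SidedParent u v) (sym (splitAt-↑ˡ l i l)) e

      leftwardForest : ∀ {u v} → ∃ (λ i → Parent leftwards i u v) → ∃ λ s → ForestParent s u v
      leftwardForest {u} {v} (i , e) = suc (l ↑ʳ i) , subst (SidedParent u v) (sym (splitAt-↑ʳ l l i)) e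

      coveredFrom : ∀ {u v} → Adj G u v → u ≺[ L ] v → ∃ λ s → ForestParent s u v ⊎ ForestParent s v u
      coveredFrom uv u≺v with parent uv u≺v
      ... | inj₁ e = let (s , f) = rightwardForest e in s , inj₁ f
      ... | inj₂ e = let (s , f) = leftwardForest e in s , inj₂ f

      covered : ∀ {u v} → Adj G u v → ∃ λ s → ForestParent s u v ⊎ ForestParent s v u
      covered {u} {v} uv with <-cmp (pos L u) (pos L v)
      ... | tri< u≺v _ _ = coveredFrom uv u≺v
      ... | tri≈ _ eq _  = contradiction (pos-inj L eq) (Adj⇒≢ G uv)
      ... | tri> _ _ v≺u with coveredFrom (Adj-sym G uv) v≺u
      ...   | s , inj₁ e = s , inj₂ e
      ...   | s , inj₂ e = s , inj₁ e

    -- There are `l` rightward forests, `l` leftward ones and the empty one, and each is cut into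
    -- two star forests.
    localBook⇒union′ : UnionEmb G (suc (l + l) * 2)
    localBook⇒union′ = forests⇒union G (pos L) (pos-inj L)
      ForestParent ForestParent? functional key decreasing covered

localBook⇒union : ∀ {n} {G : Graph n} {l} → HasLocalBook G l → UnionEmb G (4 * l + 2)
localBook⇒union {G = G} {l} (m , L , book , local) =
  subst (UnionEmb G) (solve 1 (λ l → (con 1 :+ (l :+ l)) :* con 2 := con 4 :* l :+ con 2) refl l)
    (localBook⇒union′ L local book)

-- Perfect matchings and their unions

record IsMatching {n} (σ : Fin n → Fin n) : Set where
  field
    involutive  : ∀ u → σ (σ u) ≡ u
    fixpointFree : ∀ u → σ u ≢ u

  injective : Injective _≡_ _≡_ σ
  injective {u} {v} eq = trans (sym (involutive u)) (trans (cong σ eq) (involutive v))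

  swap-≡ : ∀ {u v} → σ u ≡ v → σ v ≡ u
  swap-≡ {u} refl = involutive u

open IsMatching

from-does : ∀ {A : Set} (a? : Dec A) → does a? ≡ true → A
from-does (yes a) _ = a

module _ {n d} (σ : Fin d → Fin n → Fin n) (matching : ∀ i → IsMatching (σ i)) where

  matched? : ∀ u v → Dec (∃ λ i → σ i u ≡ v)
  matched? u v = any? (λ i → σ i u ≟ v)

  -- The matchings may overlap; an edge shared by several of them occurs once in the graph.
  matchingGraph : Graph n
  matchingGraph = record
    { adj    = λ u v → does (matched? u v)
    ; sym    = λ u v → does-⇔ (mk⇔ flip flip) (matched? u v) (matched? v u)
    ; irrefl = λ u → dec-false (matched? u u) λ (i , fixed) → fixpointFree (matching i) u fixed
    }
    where
    flip : ∀ {u v} → (∃ λ i → σ i u ≡ v) → ∃ λ i → σ i v ≡ u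
    flip (i , eq) = i , swap-≡ (matching i) eq

  matched : ∀ {u v} → Adj matchingGraph u v → ∃ λ i → σ i u ≡ v
  matched {u} {v} = from-does (matched? u v)

  mate-adj : ∀ i u → Adj matchingGraph u (σ i u)
  mate-adj i u = dec-true (matched? u (σ i u)) (i , refl)

module _ {n d} (σ : Fin (suc d) → Fin n → Fin n) (matching : ∀ i → IsMatching (σ i)) where

  private
    G : Graph n
    G = matchingGraph σ matching

    index : Fin n → Fin n → Fin (suc d)
    index u v with matched? σ matching u v
    ... | yes (i , _) = i
    ... | no  _       = zero

    index-mate : ∀ {u v} → Adj G u v → σ (index u v) u ≡ v
    index-mate {u} {v} uv with matched? σ matching u v
    ... | yes (_ , eq) = eq
    ... | no unmatched = contradiction (matched σ matching uv) unmatched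

    L : LinEmb G (suc d)
    L = record
      { pos = λ u → u ; pos-inj = λ eq → eq
      ; page = symmetrise index ; page-sym = λ u v _ → symmetrise-sym index u v }

    page-mate : ∀ {u v} → Adj G u v → σ (page L u v) u ≡ v
    page-mate {u} {v} uv = symmetrise-cases (λ i → σ i u ≡ v) index u v (index-mate uv)
      (swap-≡ (matching (index v u)) (index-mate (Adj-sym G uv)))

    -- Each component of a page with an edge is a single matching edge, viewed as a star centred at
    -- its smaller end.
    centre : Fin (suc d) → Fin n → Fin n
    centre i u = symmetrise (λ v _ → v) u (σ i u)

    centre-const : ∀ {u v} i → σ i u ≡ v → centre i u ≡ centre i v
    centre-const {u} i refl = trans (symmetrise-sym _ u (σ i u))
      (cong (symmetrise (λ v _ → v) (σ i u)) (sym (involutive (matching i) u)))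

    centre-end : ∀ {u v} i → σ i u ≡ v → centre i u ≡ u ⊎ centre i u ≡ v
    centre-end {u} i refl = symmetrise-cases (λ c → c ≡ u ⊎ c ≡ σ i u) (λ v _ → v) u (σ i u)
      (inj₁ refl) (inj₂ refl)

  matchings⇒union : UnionEmb G (suc d)
  matchings⇒union = L , stars⇒union L centre
    (λ {u} {v} → centre-const (page L u v) ∘ page-mate)
    (λ {u} {v} → centre-end (page L u v) ∘ page-mate)

-- Reconstructing a matching from its pages and directions

direction : ∀ {n} → Fin n → Fin n → Fin 2
direction a b with toℕ a <? toℕ b
... | yes _ = zero
... | no  _ = suc zero

direction-< : ∀ {n} {a b c d : Fin n} → direction a b ≡ direction c d → toℕ a < toℕ b → toℕ c < toℕ d
direction-< {a = a} {b} {c} {d} eq a<b with toℕ a <? toℕ b | toℕ c <? toℕ d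
... | yes _ | yes c<d = c<d
... | no a≮b | _      = contradiction a<b a≮b
direction-< () a<b | yes _ | no _

module _ {n m} (p : Fin n → Fin n) (col : Fin n → Fin m) (dir : Fin n → Fin 2) where

  NoCrossing : (σ : Fin n → Fin n) → Fin n → Fin n → Set
  NoCrossing σ u x = ¬ ((toℕ (p u) < toℕ (p x) × toℕ (p x) < toℕ (p (σ u)))
    × toℕ (p (σ u)) < toℕ (p (σ x)))

  -- What a book embedding imposes on one matching, stated without the graph and the embedding so
  -- that it can be tested against a code alone.
  Describes : (Fin n → Fin n) → Set
  Describes σ = (∀ u → col (σ u) ≡ col u)
    × (∀ u → dir u ≡ direction (p u) (p (σ u)))
    × (∀ u x → col u ≡ col x → NoCrossing σ u x)

  Describes? : ∀ σ → Dec (Describes σ)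
  Describes? σ = all? (λ u → col (σ u) ≟ col u)
    ×-dec (all? (λ u → dir u ≟ direction (p u) (p (σ u)))
    ×-dec all? (λ u → all? λ x → (col u ≟ col x) →-dec
      ¬? (((toℕ (p u) <? toℕ (p x)) ×-dec (toℕ (p x) <? toℕ (p (σ u))))
        ×-dec (toℕ (p (σ u)) <? toℕ (p (σ x))))))

-- Decoding returns functions that agree with the encoded ones pointwise; this transports a
-- description along such agreement.
Describes-cong : ∀ {n m} {p p′ : Fin n → Fin n} {col col′ : Fin n → Fin m} {dir dir′ σ} →
  p ≗ p′ → col ≗ col′ → dir ≗ dir′ → Describes p col dir σ → Describes p′ col′ dir′ σ
Describes-cong {p = p} {p′} {σ = σ} p≗ col≗ dir≗ (same , facing , planar) =
    (λ u → trans (sym (col≗ (σ u))) (trans (same u) (col≗ u)))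
  , (λ u → trans (sym (dir≗ u)) (trans (facing u) (cong₂ direction (p≗ u) (p≗ (σ u)))))
  , λ u x eq ((u<x , x<v) , v<y) → planar u x (trans (col≗ u) (trans eq (sym (col≗ x))))
      ((back u x u<x , back x (σ u) x<v) , back (σ u) (σ x) v<y)
  where
  back : ∀ a b → toℕ (p′ a) < toℕ (p′ b) → toℕ (p a) < toℕ (p b)
  back a b = subst₂ (λ i j → toℕ i < toℕ j) (sym (p≗ a)) (sym (p≗ b))

module _ {n m} {p : Fin n → Fin n} (p-injective : Injective _≡_ _≡_ p)
  {col : Fin n → Fin m} {dir : Fin n → Fin 2}
  {σ τ : Fin n → Fin n} (σ-matching : IsMatching σ) (τ-matching : IsMatching τ)
  (σ-described : Describes p col dir σ) (τ-described : Describes p col dir τ) where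

  private
    _⊏_ : Fin n → Fin n → Set
    u ⊏ v = toℕ (p u) < toℕ (p v)

    ⊏-cmp : ∀ u v → u ⊏ v ⊎ u ≡ v ⊎ v ⊏ u
    ⊏-cmp u v with <-cmp (p u) (p v)
    ... | tri< lt _ _ = inj₁ lt
    ... | tri≈ _ eq _ = inj₂ (inj₁ (p-injective eq))
    ... | tri> _ _ gt = inj₂ (inj₂ gt)

    same-direction : ∀ {u} → direction (p u) (p (σ u)) ≡ direction (p u) (p (τ u))
    same-direction {u} = trans (sym (proj₁ (proj₂ σ-described) u)) (proj₁ (proj₂ τ-described) u)

    opens-τ : ∀ {u} → u ⊏ σ u → u ⊏ τ u
    opens-τ = direction-< same-direction

    opens-σ : ∀ {u} → u ⊏ τ u → u ⊏ σ u
    opens-σ = direction-< (sym same-direction)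

    closes-σ : ∀ {u} → τ u ⊏ u → σ u ⊏ u
    closes-σ {u} c with ⊏-cmp (σ u) u
    ... | inj₁ lt        = lt
    ... | inj₂ (inj₁ eq) = contradiction eq (fixpointFree σ-matching u)
    ... | inj₂ (inj₂ gt) = contradiction (<-trans (opens-τ gt) c) (<-irrefl refl)

    closes-τ : ∀ {u} → σ u ⊏ u → τ u ⊏ u
    closes-τ {u} c with ⊏-cmp (τ u) u
    ... | inj₁ lt        = lt
    ... | inj₂ (inj₁ eq) = contradiction eq (fixpointFree τ-matching u)
    ... | inj₂ (inj₂ gt) = contradiction (<-trans (opens-σ gt) c) (<-irrefl refl)

    -- Induction on the right end of the `σ`-edge at `u`. If the two mates of `u` differ, the
    -- earlier one closes an edge in both matchings, and following that edge back to its opening end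
    -- contradicts the induction hypothesis, injectivity or planarity.
    openers-agree : ∀ B u → toℕ (p (σ u)) < B → u ⊏ σ u → σ u ≡ τ u
    openers-agree (suc B) u v<B u⊏v with ⊏-cmp (σ u) (τ u)
    ... | inj₂ (inj₁ eq) = eq
    -- The `σ`-edge closing at `v′` ends before `σ u`, so by induction it is also a `τ`-edge. Then
    -- `u` and `w` have the same `τ`-mate and coincide.
    ... | inj₂ (inj₂ v′⊏v) = contradiction
      (trans (cong σ (injective τ-matching τu≡τw)) (involutive σ-matching v′)) λ v≡v′ →
      <-irrefl (cong (toℕ ∘ p) (sym v≡v′)) v′⊏v
      where
      v′ w : Fin n
      v′ = τ u
      w = σ v′
      w⊏v′ : w ⊏ v′
      w⊏v′ = closes-σ (subst (_⊏ v′) (sym (involutive τ-matching u)) (opens-τ u⊏v))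
      σw≡v′ : σ w ≡ v′
      σw≡v′ = involutive σ-matching v′
      τu≡τw : τ u ≡ τ w
      τu≡τw = trans (sym σw≡v′) (openers-agree B w
        (subst (λ x → toℕ (p x) < B) (sym σw≡v′) (<-≤-trans v′⊏v (s≤s⁻¹ v<B)))
        (subst (w ⊏_) (sym σw≡v′) w⊏v′))
    ... | inj₁ v⊏v′ with ⊏-cmp u (τ (σ u))
    ...   | inj₂ (inj₁ eq) = sym (swap-≡ τ-matching (sym eq))
    -- The `τ`-edge closing at `σ u` would start before `u` and cross the longer `τ`-edge from `u`.
    ...   | inj₂ (inj₂ w⊏u) = contradiction
      ((w⊏u , subst (u ⊏_) (sym (involutive τ-matching (σ u))) u⊏v)
        , subst (_⊏ τ u) (sym (involutive τ-matching (σ u))) v⊏v′)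
      (proj₂ (proj₂ τ-described) (τ (σ u)) u (trans (proj₁ τ-described (σ u)) (proj₁ σ-described u)))
    -- Here `w` lies between `u` and `v` and opens in `σ` as well. If its `σ`-edge ends before `v`,
    -- induction makes `v` that end; if at `v`, then `w` is `u`; if after `v`, it crosses the
    -- `σ`-edge from `u`.
    ...   | inj₁ u⊏w = absurd (⊏-cmp (σ w) v)
      where
      v w : Fin n
      v = σ u
      w = τ v
      w⊏v : w ⊏ v
      w⊏v = closes-τ (subst (_⊏ v) (sym (involutive σ-matching u)) u⊏v)
      w⊏σw : w ⊏ σ w
      w⊏σw = opens-σ (subst (w ⊏_) (sym (involutive τ-matching v)) w⊏v)
      u≢w : u ≢ w
      u≢w eq = <-irrefl (cong (toℕ ∘ p) eq) u⊏w
      absurd : σ w ⊏ v ⊎ σ w ≡ v ⊎ v ⊏ σ w → σ u ≡ τ u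
      absurd (inj₁ z⊏v) = contradiction
        (trans (openers-agree B w (<-≤-trans z⊏v (s≤s⁻¹ v<B)) w⊏σw) (involutive τ-matching v))
        λ eq → <-irrefl (cong (toℕ ∘ p) eq) z⊏v
      absurd (inj₂ (inj₁ eq)) = contradiction (injective σ-matching (sym eq)) u≢w
      absurd (inj₂ (inj₂ v⊏z)) = contradiction ((u⊏w , w⊏v) , v⊏z)
        (proj₂ (proj₂ σ-described) u w (sym (trans (proj₁ τ-described v) (proj₁ σ-described u))))

  Describes-unique : σ ≗ τ
  Describes-unique u with ⊏-cmp u (σ u)
  ... | inj₁ u⊏ = openers-agree _ u ≤-refl u⊏
  ... | inj₂ (inj₁ eq) = contradiction (sym eq) (fixpointFree σ-matching u)
  -- A closing end is settled through its mate, which is an opening end.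
  ... | inj₂ (inj₂ ⊏u) = sym (swap-≡ τ-matching
    (trans (sym (openers-agree _ (σ u) ≤-refl (subst (σ u ⊏_) (sym (involutive σ-matching u)) ⊏u)))
      (involutive σ-matching u)))

-- Matchings from permutations

mate : ∀ {N} → Permutation′ N → Fin (N + N) → Fin (N + N)
mate {N} π x = [ (λ a → N ↑ʳ (π ⟨$⟩ʳ a)) , (λ b → (π ⟨$⟩ˡ b) ↑ˡ N) ]′ (splitAt N x)

module _ {N} (π : Permutation′ N) where

  mate-↑ˡ : ∀ a → mate π (a ↑ˡ N) ≡ N ↑ʳ (π ⟨$⟩ʳ a)
  mate-↑ˡ a rewrite splitAt-↑ˡ N a N = refl

  mate-↑ʳ : ∀ b → mate π (N ↑ʳ b) ≡ (π ⟨$⟩ˡ b) ↑ˡ N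
  mate-↑ʳ b rewrite splitAt-↑ʳ N N b = refl

  ↑ʳ≢↑ˡ : ∀ {a b} → N ↑ʳ b ≢ a ↑ˡ N
  ↑ʳ≢↑ˡ {a} {b} eq with trans (sym (splitAt-↑ʳ N N b)) (trans (cong (splitAt N) eq) (splitAt-↑ˡ N a N))
  ... | ()

  mate-matching : IsMatching (mate π)
  mate-matching = record { involutive = inv ; fixpointFree = free }
    where
    inv : ∀ u → mate π (mate π u) ≡ u
    inv u with splitAt N u in eq
    ... | inj₁ a = trans (mate-↑ʳ (π ⟨$⟩ʳ a)) (trans (cong (_↑ˡ N) (inverseˡ π))
      (splitAt⁻¹-↑ˡ eq))
    ... | inj₂ b = trans (mate-↑ˡ (π ⟨$⟩ˡ b)) (trans (cong (N ↑ʳ_) (inverseʳ π))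
      (splitAt⁻¹-↑ʳ eq))
    free : ∀ u → mate π u ≢ u
    free u fixed with splitAt N u in eq
    ... | inj₁ a = ↑ʳ≢↑ˡ (trans fixed (sym (splitAt⁻¹-↑ˡ eq)))
    ... | inj₂ b = ↑ʳ≢↑ˡ (trans (splitAt⁻¹-↑ʳ eq) (sym fixed))

mate-injective : ∀ {N} (π ρ : Permutation′ N) → mate π ≗ mate ρ → π ≈ ρ
mate-injective {N} π ρ eq a =
  ↑ʳ-injective N _ _ (trans (sym (mate-↑ˡ π a)) (trans (eq (a ↑ˡ N)) (mate-↑ˡ ρ a)))

-- Factorial base: the leading digit is the image of `zero`, and the rest codes a permutation of the
-- remaining elements. Being injective, this supplies `N !` distinct permutations.
fromLehmer : ∀ {N} → Fin (N !) → Permutation′ N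
fromLehmer {zero}  _ = Permutation.id
fromLehmer {suc N} c = insert zero (quotient (N !) c) (fromLehmer (remainder {suc N} (N !) c))

fromLehmer-injective : ∀ {N} {c c′ : Fin (N !)} → fromLehmer {N} c ≈ fromLehmer c′ → c ≡ c′
fromLehmer-injective {zero} {zero} {zero} _ = refl
fromLehmer-injective {suc N} {c} {c′} eq =
  trans (sym (combine-remQuot {suc N} (N !) c))
    (trans (cong₂ combine (eq zero) (fromLehmer-injective tail)) (combine-remQuot {suc N} (N !) c′))
  where
  tail : fromLehmer (remainder {suc N} (N !) c) ≈ fromLehmer (remainder {suc N} (N !) c′)
  tail a = punchIn-injective (quotient (N !) c) _ _
    (trans (sym (insert-punchIn zero _ (fromLehmer (remainder {suc N} (N !) c)) a))
      (trans (eq (suc a)) (trans (insert-punchIn zero _ (fromLehmer (remainder {suc N} (N !) c′)) a)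
        (cong (λ j → punchIn j (fromLehmer (remainder {suc N} (N !) c′) ⟨$⟩ʳ a)) (sym (eq zero))))))

-- Counting tuples of matchings

finToFun-injective : ∀ {m n} {c c′ : Fin (m ^ n)} → finToFun {m} {n} c ≗ finToFun c′ → c ≡ c′
finToFun-injective {m} {n} {c} {c′} eq =
  trans (sym (funToFin-finToFin {n} {m} c)) (trans (funToFin-cong eq) (funToFin-finToFin {n} {m} c′))
  where
  funToFin-cong : ∀ {k} {f g : Fin k → Fin m} → f ≗ g → funToFin f ≡ funToFin g
  funToFin-cong {zero}  _  = refl
  funToFin-cong {suc k} eq = cong₂ combine (eq zero) (funToFin-cong (eq ∘ suc))

-- Pigeonhole: if every `i` had a related `j`, choosing one would inject `Fin a` into `Fin b`.
-- Decidability turns the failure into a witness.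
unrelated : ∀ {a b} (R : Fin a → Fin b → Set) → (∀ i j → Dec (R i j)) →
  (∀ {i i′ j} → R i j → R i′ j → i ≡ i′) → b < a → ∃ λ i → ∀ j → ¬ R i j
unrelated R R? unique b<a with ¬∀⟶∃¬ _ (λ i → ∃ (R i)) (λ i → any? (R? i))
  (λ total → <⇒notInjective {f = λ i → proj₁ (total i)} b<a λ {i} {i′} eq →
    unique (proj₂ (total i)) (subst (R i′) (sym eq) (proj₂ (total i′))))
... | i , ¬R = i , λ j r → ¬R (j , r)

module _ (N d : ℕ) where

  private
    n : ℕ
    n = N + N

  Tuple : Set
  Tuple = Fin ((N !) ^ d)

  tuplePerm : Tuple → Fin d → Permutation′ N
  tuplePerm F i = fromLehmer (finToFun {N !} {d} F i)

  tupleGraph : Tuple → Graph n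
  tupleGraph F = matchingGraph (mate ∘ tuplePerm F) (mate-matching ∘ tuplePerm F)

  module _ (m : ℕ) where

    -- The first factor counts spine maps; the second counts, for each of the `d` matchings, the
    -- ways to mark every vertex with a page and a direction.
    Code : Set
    Code = Fin (n ^ n * ((m * 2) ^ n) ^ d)

    spine : Code → Fin n → Fin n
    spine c = finToFun {n} {n} (quotient (((m * 2) ^ n) ^ d) c)

    mark : Code → Fin d → Fin n → Fin (m * 2)
    mark c i = finToFun {m * 2} {n}
      (finToFun {(m * 2) ^ n} {d} (remainder {n ^ n} (((m * 2) ^ n) ^ d) c) i)

    Codes : Tuple → Code → Set
    Codes F c = (∀ u v → spine c u ≡ spine c v → u ≡ v)
      × ∀ i → Describes (spine c) (quotient {m} 2 ∘ mark c i) (remainder {m} 2 ∘ mark c i)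
          (mate (tuplePerm F i))

    Codes? : ∀ F c → Dec (Codes F c)
    Codes? F c = all? (λ u → all? λ v → (spine c u ≟ spine c v) →-dec (u ≟ v))
      ×-dec all? (λ i → Describes? _ _ _ (mate (tuplePerm F i)))

    Codes-unique : ∀ {F F′ c} → Codes F c → Codes F′ c → F ≡ F′
    Codes-unique {F} {F′} {c} (inj , φ) (_ , ψ) = finToFun-injective λ i → fromLehmer-injective {N}
      (mate-injective (tuplePerm F i) (tuplePerm F′ i) (Describes-unique (λ {u} {v} → inj u v)
        (mate-matching (tuplePerm F i)) (mate-matching (tuplePerm F′ i)) (φ i) (ψ i)))

    module _ (p : Fin n → Fin n) (col : Fin d → Fin n → Fin m) (dir : Fin d → Fin n → Fin 2) where

      private
        row : Fin d → Fin ((m * 2) ^ n)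
        row i = funToFin λ u → combine (col i u) (dir i u)

      encode : Code
      encode = combine (funToFin p) (funToFin row)

      spine-encode : spine encode ≗ p
      spine-encode u = trans
        (cong (λ (q , _) → finToFun {n} {n} q u) (remQuot-combine (funToFin p) (funToFin row)))
        (finToFun-funToFin p u)

      mark-encode : ∀ i → mark encode i ≗ λ u → combine (col i u) (dir i u)
      mark-encode i u = trans
        (cong (λ (_ , r) → finToFun {m * 2} {n} (finToFun {(m * 2) ^ n} {d} r i) u)
          (remQuot-combine (funToFin p) (funToFin row)))
        (trans (cong (λ q → finToFun {m * 2} {n} q u) (finToFun-funToFin row i))
          (finToFun-funToFin _ u))

      page-encode : ∀ i → quotient {m} 2 ∘ mark encode i ≗ col i
      page-encode i u = trans (cong (quotient {m} 2) (mark-encode i u))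
        (cong proj₁ (remQuot-combine (col i u) (dir i u)))

      direction-encode : ∀ i → remainder {m} 2 ∘ mark encode i ≗ dir i
      direction-encode i u = trans (cong (remainder {m} 2) (mark-encode i u))
        (cong proj₂ (remQuot-combine (col i u) (dir i u)))

    -- Pages are embedded into `Fin m`, so that one set of codes serves all page counts up to `m`.
    book-code : ∀ F {m′} → m′ ≤ m → BookEmb (tupleGraph F) m′ → ∃ (Codes F)
    book-code F {m′} m′≤m (L , book) = encode p col dir ,
        (λ u v eq → pos-inj L
          (trans (sym (spine-encode p col dir u)) (trans eq (spine-encode p col dir v))))
      , λ i → Describes-cong (λ u → sym (spine-encode p col dir u))
          (λ u → sym (page-encode p col dir i u)) (λ u → sym (direction-encode p col dir i u))
          (describes i)
      where
      σ : Fin d → Fin n → Fin n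
      σ i = mate (tuplePerm F i)
      σ-matching : ∀ i → IsMatching (σ i)
      σ-matching i = mate-matching (tuplePerm F i)
      p : Fin n → Fin n
      p = pos L
      col : Fin d → Fin n → Fin m
      col i u = inject≤ (page L u (σ i u)) m′≤m
      dir : Fin d → Fin n → Fin 2
      dir i u = direction (p u) (p (σ i u))
      σ-adj : ∀ i u → Adj (tupleGraph F) u (σ i u)
      σ-adj = mate-adj σ σ-matching
      describes : ∀ i → Describes p (col i) (dir i) (σ i)
      describes i =
          (λ u → cong (λ P → inject≤ P m′≤m) (trans (cong (page L (σ i u)) (involutive (σ-matching i) u))
            (sym (page-sym L u (σ i u) (σ-adj i u)))))
        , (λ u → refl)
        , λ u x eq ((u<x , x<v) , v<y) → book u (σ i u) x (σ i x) (σ-adj i u) (σ-adj i x) (u<x , x<v , v<y)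
            (inject≤-injective m′≤m m′≤m _ _ eq)

    hardTuple : n ^ n * ((m * 2) ^ n) ^ d < (N !) ^ d →
      ∃ λ F → ∀ m′ → m′ ≤ m → ¬ BookEmb (tupleGraph F) m′
    hardTuple fewCodes with unrelated Codes Codes? Codes-unique fewCodes
    ... | F , ¬coded = F , λ m′ m′≤m book → let (c , coded) = book-code F m′≤m book in ¬coded c coded

-- Estimates for powers and factorials

^-distribʳ-* : ∀ a b e → (a * b) ^ e ≡ a ^ e * b ^ e
^-distribʳ-* a b zero    = refl
^-distribʳ-* a b (suc e) = trans (cong (a * b *_) (^-distribʳ-* a b e))
  (solve 4 (λ a b x y → a :* b :* (x :* y) := a :* x :* (b :* y)) refl a b (a ^ e) (b ^ e))

^-swap : ∀ a e f → (a ^ e) ^ f ≡ (a ^ f) ^ e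
^-swap a e f = trans (^-*-assoc a e f) (trans (cong (a ^_) (*-comm e f)) (sym (^-*-assoc a f e)))

^-cancelʳ-≤ : ∀ e .{{_ : NonZero e}} {a b} → a ^ e ≤ b ^ e → a ≤ b
^-cancelʳ-≤ e aᵉ≤bᵉ = ≮⇒≥ λ b<a → <⇒≱ (^-monoˡ-< e b<a) aᵉ≤bᵉ

-- Each of the `b` further factors of the larger factorial is at least `N`.
N^b*N!≤[b+N]! : ∀ N b → N ^ b * N ! ≤ (b + N) !
N^b*N!≤[b+N]! N zero    = ≤-reflexive (+-identityʳ (N !))
N^b*N!≤[b+N]! N (suc b) = begin
  N * N ^ b * N !             ≡⟨ *-assoc N (N ^ b) (N !) ⟩
  N * (N ^ b * N !)           ≤⟨ *-mono-≤ (m≤n+m N (suc b)) (N^b*N!≤[b+N]! N b) ⟩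
  (suc b + N) * (b + N) !     ∎

double-^ : ∀ N → (N + N) ^ (N + N) ≡ N ^ N * N ^ N * 4 ^ N
double-^ N = begin-equality
  (N + N) ^ (N + N)           ≡⟨ ^-distribˡ-+-* (N + N) N N ⟩
  (N + N) ^ N * (N + N) ^ N   ≡⟨ ^-distribʳ-* (N + N) (N + N) N ⟨
  ((N + N) * (N + N)) ^ N     ≡⟨ cong (_^ N) (solve 1 (λ N → (N :+ N) :* (N :+ N) := N :* N :* con 4) refl N) ⟩
  (N * N * 4) ^ N             ≡⟨ ^-distribʳ-* (N * N) 4 N ⟩
  (N * N) ^ N * 4 ^ N         ≡⟨ cong (_* 4 ^ N) (^-distribʳ-* N N N) ⟩
  N ^ N * N ^ N * 4 ^ N       ∎

suc-2^ : ∀ r → 2 ^ suc r ≡ 2 ^ r + 2 ^ r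
suc-2^ r = cong (2 ^ r +_) (+-identityʳ (2 ^ r))

-- Doubling gains a factor of at least N ^ N, so powers of two need no Stirling estimate.
factorial-bound : ∀ r → let N = 2 ^ r in N ^ N ≤ N ! * 4 ^ N
factorial-bound zero    = s≤s z≤n
factorial-bound (suc r) = subst (λ M → M ^ M ≤ M ! * 4 ^ M) (sym (suc-2^ r)) (begin
  (N + N) ^ (N + N)                 ≡⟨ double-^ N ⟩
  N ^ N * N ^ N * 4 ^ N             ≤⟨ *-monoˡ-≤ (4 ^ N) (*-monoʳ-≤ (N ^ N) (factorial-bound r)) ⟩
  N ^ N * (N ! * 4 ^ N) * 4 ^ N     ≡⟨ solve 3 (λ a b c → a :* (b :* c) :* c := a :* b :* (c :* c)) refl (N ^ N) (N !) (4 ^ N) ⟩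
  N ^ N * N ! * (4 ^ N * 4 ^ N)     ≡⟨ cong (N ^ N * N ! *_) (^-distribˡ-+-* 4 N N) ⟨
  N ^ N * N ! * 4 ^ (N + N)         ≤⟨ *-monoˡ-≤ (4 ^ (N + N)) (N^b*N!≤[b+N]! N N) ⟩
  (N + N) ! * 4 ^ (N + N)           ∎)
  where
  N = 2 ^ r

module _ (r d m : ℕ) where

  private
    N n : ℕ
    N = 2 ^ r
    n = N + N

    instance
      N≢0 : NonZero N
      N≢0 = m^n≢0 2 r

    n^N≤N!*8^N : n ^ N ≤ N ! * 8 ^ N
    n^N≤N!*8^N = begin
      n ^ N                ≡⟨ cong (_^ N) (cong (N +_) (+-identityʳ N)) ⟨
      (2 * N) ^ N          ≡⟨ ^-distribʳ-* 2 N N ⟩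
      2 ^ N * N ^ N        ≤⟨ *-monoʳ-≤ (2 ^ N) (factorial-bound r) ⟩
      2 ^ N * (N ! * 4 ^ N) ≡⟨ solve 3 (λ a b c → a :* (b :* c) := b :* (a :* c)) refl (2 ^ N) (N !) (4 ^ N) ⟩
      N ! * (2 ^ N * 4 ^ N) ≡⟨ cong (N ! *_) (^-distribʳ-* 2 4 N) ⟨
      N ! * 8 ^ N          ∎

    square : ∀ a → a ^ n ≡ (a * a) ^ N
    square a = trans (^-distribˡ-+-* a N N) (sym (^-distribʳ-* a a N))

    8*[2m]² : m * 2 * (m * 2) * 8 ≡ 32 * (m * m)
    8*[2m]² = solve 1 (λ m → m :* con 2 :* (m :* con 2) :* con 8 := con 32 :* (m :* m)) refl m

  -- Replacing `N !` by `n ^ N` at the cost of `8 ^ N` makes both sides `N`-th powers, as `n` is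
  -- twice `N`. The constant 32 is 8 times the 4 from squaring `m * 2`.
  manyCodes⇒ : (N !) ^ d ≤ n ^ n * ((m * 2) ^ n) ^ d → n ^ d ≤ n * n * (32 * (m * m)) ^ d
  manyCodes⇒ manyCodes = ^-cancelʳ-≤ N (begin
    (n ^ d) ^ N                                          ≡⟨ ^-swap n d N ⟩
    (n ^ N) ^ d                                          ≤⟨ ^-monoˡ-≤ d n^N≤N!*8^N ⟩
    (N ! * 8 ^ N) ^ d                                    ≡⟨ ^-distribʳ-* (N !) (8 ^ N) d ⟩
    (N !) ^ d * (8 ^ N) ^ d                              ≤⟨ *-monoˡ-≤ ((8 ^ N) ^ d) manyCodes ⟩
    n ^ n * ((m * 2) ^ n) ^ d * (8 ^ N) ^ d              ≡⟨ *-assoc (n ^ n) (((m * 2) ^ n) ^ d) ((8 ^ N) ^ d) ⟩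
    n ^ n * (((m * 2) ^ n) ^ d * (8 ^ N) ^ d)            ≡⟨ cong (n ^ n *_) (^-distribʳ-* ((m * 2) ^ n) (8 ^ N) d) ⟨
    n ^ n * ((m * 2) ^ n * 8 ^ N) ^ d                    ≡⟨ cong₂ (λ a b → a * (b * 8 ^ N) ^ d) (square n) (square (m * 2)) ⟩
    (n * n) ^ N * ((m * 2 * (m * 2)) ^ N * 8 ^ N) ^ d    ≡⟨ cong (λ a → (n * n) ^ N * a ^ d) (^-distribʳ-* (m * 2 * (m * 2)) 8 N) ⟨
    (n * n) ^ N * ((m * 2 * (m * 2) * 8) ^ N) ^ d        ≡⟨ cong (λ a → (n * n) ^ N * (a ^ N) ^ d) 8*[2m]² ⟩
    (n * n) ^ N * ((32 * (m * m)) ^ N) ^ d               ≡⟨ cong ((n * n) ^ N *_) (^-swap (32 * (m * m)) N d) ⟩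
    (n * n) ^ N * ((32 * (m * m)) ^ d) ^ N               ≡⟨ ^-distribʳ-* (n * n) ((32 * (m * m)) ^ d) N ⟨
    (n * n * (32 * (m * m)) ^ d) ^ N                     ∎)

-- With k + 2 matchings the exponent of n exceeds the required one, and that surplus absorbs
-- all constants and powers of k once n is large.
largeOrder⇒bound : ∀ j n m → let k = 2 + j in (32 * k) ^ (k * (k + 2)) < n →
  n ^ (k + 2) ≤ n * n * (32 * (m * m)) ^ (k + 2) → k ^ k * n ^ j ≤ m ^ (2 * k)
largeOrder⇒bound j n m large bound = ≮⇒≥ λ few → <⇒≱ large (n≤ (<⇒≤ few))
  where
  k d : ℕ
  k = 2 + j
  d = k + 2

  instance
    n≢0 : NonZero n
    n≢0 = >-nonZero (≤-<-trans z≤n large)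

  n^k≤ : n ^ k ≤ (32 * (m * m)) ^ d
  n^k≤ = *-cancelˡ-≤ (n * n) {{m*n≢0 n n}} (begin
    n * n * n ^ k               ≡⟨ solve 2 (λ n x → n :* n :* x := x :* (n :* (n :* con 1))) refl n (n ^ k) ⟩
    n ^ k * n ^ 2               ≡⟨ ^-distribˡ-+-* n k 2 ⟨
    n ^ d                       ≤⟨ bound ⟩
    n * n * (32 * (m * m)) ^ d  ∎)

  m²≡ : (m * m) ^ k ≡ m ^ (2 * k)
  m²≡ = trans (cong (λ a → (m * a) ^ k) (sym (*-identityʳ m))) (^-*-assoc m 2 k)

  [k-2][k+2]+4≡k² : j * d + 4 ≡ k * k
  [k-2][k+2]+4≡k² = solve 1 (λ j → j :* (con 2 :+ j :+ con 2) :+ con 4 := (con 2 :+ j) :* (con 2 :+ j))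
    refl j

  n≤ : m ^ (2 * k) ≤ k ^ k * n ^ j → n ≤ (32 * k) ^ (k * d)
  -- The `k`-th power of `n^k≤` leaves a surplus of `n ^ 4` over `n ^ (j * d)`, of which a single
  -- factor `n` is kept.
  n≤ few = ≤-trans (m≤m*n n (n ^ 3) {{m^n≢0 n 3}}) (*-cancelˡ-≤ (n ^ (j * d)) {{m^n≢0 n (j * d)}} (begin
    n ^ (j * d) * n ^ 4                      ≡⟨ ^-distribˡ-+-* n (j * d) 4 ⟨
    n ^ (j * d + 4)                          ≡⟨ cong (n ^_) [k-2][k+2]+4≡k² ⟩
    n ^ (k * k)                              ≡⟨ ^-*-assoc n k k ⟨
    (n ^ k) ^ k                              ≤⟨ ^-monoˡ-≤ k n^k≤ ⟩
    ((32 * (m * m)) ^ d) ^ k                 ≡⟨ ^-swap (32 * (m * m)) d k ⟩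
    ((32 * (m * m)) ^ k) ^ d                 ≡⟨ cong (_^ d) (^-distribʳ-* 32 (m * m) k) ⟩
    (32 ^ k * (m * m) ^ k) ^ d               ≡⟨ cong (λ a → (32 ^ k * a) ^ d) m²≡ ⟩
    (32 ^ k * m ^ (2 * k)) ^ d               ≤⟨ ^-monoˡ-≤ d (*-monoʳ-≤ (32 ^ k) few) ⟩
    (32 ^ k * (k ^ k * n ^ j)) ^ d           ≡⟨ cong (_^ d) (*-assoc (32 ^ k) (k ^ k) (n ^ j)) ⟨
    (32 ^ k * k ^ k * n ^ j) ^ d             ≡⟨ cong (λ a → (a * n ^ j) ^ d) (^-distribʳ-* 32 k k) ⟨
    ((32 * k) ^ k * n ^ j) ^ d               ≡⟨ ^-distribʳ-* ((32 * k) ^ k) (n ^ j) d ⟩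
    ((32 * k) ^ k) ^ d * (n ^ j) ^ d         ≡⟨ cong₂ _*_ (^-*-assoc (32 * k) k d) (^-*-assoc n j d) ⟩
    (32 * k) ^ (k * d) * n ^ (j * d)         ≡⟨ *-comm ((32 * k) ^ (k * d)) (n ^ (j * d)) ⟩
    n ^ (j * d) * (32 * k) ^ (k * d)         ∎))

-- Choosing the hard graph

threshold : ∀ {P : ℕ → Set} → (∀ x → Dec (P x)) → ¬ P 0 → ∀ b → P b → ∃ λ x → ¬ P x × P (suc x)
threshold P? ¬P0 zero    P0 = contradiction P0 ¬P0
threshold P? ¬P0 (suc b) Pb with P? b
... | yes p = threshold P? ¬P0 b p
... | no ¬p = b , ¬p , Pb

x<2^x : ∀ x → x < 2 ^ x
x<2^x zero    = s≤s z≤n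
x<2^x (suc x) = begin-strict
  suc x         <⟨ s≤s (x<2^x x) ⟩
  1 + 2 ^ x     ≤⟨ +-monoˡ-≤ (2 ^ x) (m^n>0 2 x) ⟩
  2 ^ x + 2 ^ x ≡⟨ suc-2^ x ⟨
  2 ^ suc x     ∎

-- One tuple has to work for all `m`. At the `x` with `x ^ e < X` and `X ≤ suc x ^ e` there are too
-- few codes, so some tuple has no embedding with at most `x` pages; every larger `m` satisfies the
-- bound anyway.
hardTuple-uniform : ∀ N d X e → 0 < X → ¬ X ≤ 0 ^ e → X ≤ X ^ e →
  (∀ x → (N !) ^ d ≤ (N + N) ^ (N + N) * ((x * 2) ^ (N + N)) ^ d → X ≤ x ^ e) →
  Σ (Tuple N d) λ F → ∀ m → BookEmb (tupleGraph N d F) m → X ≤ m ^ e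
hardTuple-uniform N d X e X>0 X≰0 X≤Xᵉ counting
  with threshold (λ m → X ≤? m ^ e) X≰0 X X≤Xᵉ
... | x , fails , enough = map₂
  (λ noBook m book → ≮⇒≥ λ lt → noBook m (≮⇒≥ λ x<m → <⇒≱ lt (≤-trans enough (^-monoˡ-≤ e x<m))) book)
  (hardTuple N d x (≰⇒> (fails ∘ counting x)))

hardTuple-large : ∀ j r → let k = 2 + j in (32 * k) ^ (k * (k + 2)) < 2 ^ r + 2 ^ r →
  Σ (Tuple (2 ^ r) (k + 2)) λ F → ∀ m → BookEmb (tupleGraph (2 ^ r) (k + 2) F) m →
    k ^ k * (2 ^ r + 2 ^ r) ^ j ≤ m ^ (2 * k)
hardTuple-large j r large = hardTuple-uniform (2 ^ r) (k + 2) X (2 * k) X>0 (<⇒≱ X>0)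
  -- This is `X ≤ X ^ (2 * k)`, as `2 * k` unfolds to the successor of `1 + j + (k + 0)`; it bounds
  -- the search for the threshold by `X`.
  (m≤m*n X (X ^ (1 + j + (k + 0))) {{m^n≢0 X (1 + j + (k + 0)) {{>-nonZero X>0}}}})
  λ m manyCodes → largeOrder⇒bound j (2 ^ r + 2 ^ r) m large (manyCodes⇒ r (k + 2) m manyCodes)
  where
  k X : ℕ
  k = 2 + j
  X = k ^ k * (2 ^ r + 2 ^ r) ^ j

  X>0 : 0 < X
  X>0 = *-mono-≤ (m^n>0 k k) (m^n>0 (2 ^ r + 2 ^ r) {{>-nonZero (≤-<-trans z≤n large)}} j)

matchingUnion : ∀ N d F → UnionEmb (tupleGraph N (suc d) F) (suc d)
matchingUnion N d F = matchings⇒union (mate ∘ tuplePerm N (suc d) F)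
  (mate-matching ∘ tuplePerm N (suc d) F)

hardGraph : ∀ j M → let k = 2 + j in
  Σ ℕ λ n → M ≤ n × Σ (Graph n) λ G → UnionEmb G (k + 2)
    × (∀ m → BookEmb G m → k ^ k * n ^ j ≤ m ^ (2 * k))
-- With `r` equal to `M + B`, the order `2 ^ r + 2 ^ r` exceeds both the requested `M` and the bound
-- `B` that `hardTuple-large` asks for.
hardGraph j M = build (M + B) (m≤m+n M B)
  (hardTuple-large j (M + B) (≤-<-trans (m≤n+m B M) (r<2^r+2^r (M + B))))
  where
  k B : ℕ
  k = 2 + j
  B = (32 * k) ^ (k * (k + 2))

  r<2^r+2^r : ∀ r → r < 2 ^ r + 2 ^ r
  r<2^r+2^r r = <-≤-trans (x<2^x r) (m≤m+n (2 ^ r) (2 ^ r))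

  build : ∀ r → M ≤ r →
    (Σ (Tuple (2 ^ r) (k + 2)) λ F → ∀ m → BookEmb (tupleGraph (2 ^ r) (k + 2) F) m →
      k ^ k * (2 ^ r + 2 ^ r) ^ j ≤ m ^ (2 * k)) →
    Σ ℕ λ n → M ≤ n × Σ (Graph n) λ G → UnionEmb G (k + 2)
      × (∀ m → BookEmb G m → k ^ k * n ^ j ≤ m ^ (2 * k))
  build r M≤r (F , bound) = 2 ^ r + 2 ^ r , ≤-trans M≤r (<⇒≤ (r<2^r+2^r r))
    , tupleGraph (2 ^ r) (k + 2) F
    , matchingUnion (2 ^ r) (suc j + 2) F , bound

-- The lower bound on the page number is raised to the power `2 * k`, which clears the root and the
-- fractional exponent; the constant is `p / q`, and the proof takes it to be 1.
theorem1 : (Σ ℕ λ p → Σ ℕ λ q → 1 ≤ p × 1 ≤ q ×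
    ((k : ℕ) → 3 ≤ k → (N : ℕ) → Σ ℕ λ n → N ≤ n × Σ (Graph n) λ G →
    ((m : ℕ) → UnionEmb G m → HasLocalBook G m)
    × UnionEmb G (k + 2)
    × ((m : ℕ) → BookEmb G m →
    p ^ (2 * k) * k ^ k * n ^ (k ∸ 2) ≤ m ^ (2 * k) * q ^ (2 * k))))
    × ((n : ℕ) (G : Graph n) (l : ℕ) → HasLocalBook G l → UnionEmb G (4 * l + 2))
theorem1 = (1 , 1 , ≤-refl , ≤-refl , lower) , λ _ _ _ → localBook⇒union
  where
  lower : (k : ℕ) → 3 ≤ k → (N : ℕ) → Σ ℕ λ n → N ≤ n × Σ (Graph n) λ G →
    ((m : ℕ) → UnionEmb G m → HasLocalBook G m)
    × UnionEmb G (k + 2)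
    × ((m : ℕ) → BookEmb G m →
    1 ^ (2 * k) * k ^ k * n ^ (k ∸ 2) ≤ m ^ (2 * k) * 1 ^ (2 * k))
  lower 1 (s≤s ())
  -- Writing `k` as `2 + j` turns `k ∸ 2` into `j`; the rewriting only removes the powers of 1.
  lower (suc (suc j)) _ M = map₂ (λ {n} → map₂ (map₂ λ (union , bound) →
    (λ _ → union⇒localBook) , union , λ m book → subst₂ _≤_
      (cong (_* n ^ j) (sym (trans (cong (_* k ^ k) (^-zeroˡ (2 * k))) (*-identityˡ (k ^ k)))))
      (sym (trans (cong (m ^ (2 * k) *_) (^-zeroˡ (2 * k))) (*-identityʳ (m ^ (2 * k)))))
      (bound m book))) (hardGraph j M)
    where
    k : ℕ
    k = 2 + j
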